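{- For each $n \geq 5$, $\text{ex}(n,I_0)=n(n-2)$, and for each $n \geq 6$ there are exactly $(n-1)^n$ different labeled $I_0$-free $(2\to1)$-graphs (i.e. on the fixed vertex set $\{1,\dots,n\}$) that attain this maximum number of edges.
   Context: A $(2\to 1)$-graph (directed hypergraph) is a pair $H=(V,E)$ with $V$ a finite set and $E$ a set of pointed $3$-subsets of $V$: an edge, written $ab\to c$ (same as $ba\to c$), consists of three distinct vertices with head $c$ and tail set $\{a,b\}$. A $3$-subset of $V$ may carry up to three edges. $H$ is $F$-free if there is no injective map $\phi:V(F)\to V(H)$ such that $ab\to c\in E(F)$ implies $\phi(a)\phi(b)\to\phi(c)\in E(H)$. $\text{ex}(n,F)$ is the maximum number of edges of an $F$-free $(2\to1)$-graph on $n$ vertices. $I_0$ is the $(2\to1)$-graph with vertex set $\{a,b,c,d,x\}$ (five distinct vertices) and edges $ab\to x$, $cd\to x$. -}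

module Defs where

open import Data.Bool.Base using (Bool; true; false; T)
open import Data.Bool.Properties using (T?) renaming (_≟_ to _≟ᵇ_)
open import Data.Fin.Base using (Fin; _<_)
open import Data.Fin.Patterns using (0F; 1F; 2F; 3F; 4F)
open import Data.Fin.Properties using (_≟_; _<?_; all?)
open import Data.List.Base using (List; allFin; cartesianProduct; filter; length)
open import Data.Nat.Base using (ℕ; _≤_)
open import Data.Product.Base using (Σ; ∃; _×_; _,_; proj₁)
open import Function.Definitions using (Injective)
open import Level using (0ℓ)
open import Relation.Binary.Bundles using (Setoid)
open import Relation.Binary.PropositionalEquality.Core using (_≡_; _≢_; refl; sym; trans)
open import Relation.Nullary.Decidable using (_×-dec_; _→-dec_; ¬?; from-yes)
open import Relation.Nullary.Negation.Core using (¬_)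

-- A (2→1)-graph on the labeled vertex set Fin n.  The set of pointed
-- 3-subsets is given by its characteristic function: edge a b c says whether
-- ab→c is present.  As ab→c and ba→c are the same edge, it is symmetric in
-- the tail.
record Graph (n : ℕ) : Set where
  field
    edge      : Fin n → Fin n → Fin n → Bool
    symmetric : ∀ a b c → edge a b c ≡ edge b a c
    distinct  : ∀ a b c → T (edge a b c) → a ≢ b × a ≢ c × b ≢ c

open Graph public

-- Equality of edge sets.
_≈_ : ∀ {n} → Graph n → Graph n → Set
G ≈ H = ∀ a b c → edge G a b c ≡ edge H a b c

-- The edge ab→c is listed once, as (c , a , b) with a < b.
edges : ∀ {n} → Graph n → List (Fin n × Fin n × Fin n)
edges {n} H =
  filter (λ (c , a , b) → (a <? b) ×-dec T? (edge H a b c))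
         (cartesianProduct (allFin n) (cartesianProduct (allFin n) (allFin n)))

#edges : ∀ {n} → Graph n → ℕ
#edges H = length (edges H)

_IsFreeOf_ : ∀ {n k} → Graph n → Graph k → Set
_IsFreeOf_ {n} {k} H F =
  ¬ (Σ (Fin k → Fin n) λ φ →
       Injective _≡_ _≡_ φ ×
       (∀ a b c → T (edge F a b c) → T (edge H (φ a) (φ b) (φ c))))

IsExtremal : ∀ {n k} → Graph k → Graph n → Set
IsExtremal {n} F H =
  H IsFreeOf F × (∀ (G : Graph n) → G IsFreeOf F → #edges G ≤ #edges H)

-- ex(n,F) = m.  This is a relation since the maximum does not exist when
-- there is no F-free graph on n vertices (e.g. F edgeless and small).
ex[_,_]≡_ : ∀ {k} → ℕ → Graph k → ℕ → Set
ex[ n , F ]≡ m = ∃ λ (H : Graph n) → IsExtremal F H × #edges H ≡ m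

extremalGraphs : ∀ {k} → ℕ → Graph k → Setoid 0ℓ 0ℓ
extremalGraphs n F = record
  { Carrier       = Σ (Graph n) (IsExtremal F)
  ; _≈_           = λ G H → proj₁ G ≈ proj₁ H
  ; isEquivalence = record
    { refl  = λ a b c → refl
    ; sym   = λ p a b c → sym (p a b c)
    ; trans = λ p q a b c → trans (p a b c) (q a b c)
    }
  }

-- a, b, c, d, x are 0F, 1F, 2F, 3F, 4F.
I₀-edge : Fin 5 → Fin 5 → Fin 5 → Bool
I₀-edge 0F 1F 4F = true
I₀-edge 1F 0F 4F = true
I₀-edge 2F 3F 4F = true
I₀-edge 3F 2F 4F = true
I₀-edge _  _  _  = false

I₀ : Graph 5
I₀ = record
  { edge      = I₀-edge
  ; symmetric = from-yes (all? λ a → all? λ b → all? λ c →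
                  I₀-edge a b c ≟ᵇ I₀-edge b a c)
  ; distinct  = from-yes (all? λ a → all? λ b → all? λ c →
                  T? (I₀-edge a b c) →-dec
                  (¬? (a ≟ b) ×-dec ¬? (a ≟ c) ×-dec ¬? (b ≟ c)))
  }

{-# OPTIONS --safe #-}
-- For a vertex x let the link of x be the graph formed by the tails of the
-- edges with head x.  H is I₀-free iff every link is an intersecting family of
-- 2-sets on the other n − 1 vertices.  If no vertex meets all edges of such a
-- family, then its edges form a triangle; so a link has at most n − 2 edges once
-- n ≥ 5, and for n ≥ 6 only full stars attain this bound.  An extremal graph is
-- therefore a choice, for each vertex x, of the centre of a full star among the
-- n − 1 vertices other than x.
module Submission where

open import Data.Bool.Base using (Bool; T)
open import Data.Bool.Properties using (T?)
open import Data.Fin.Base using (Fin; _<_; punchIn; punchOut; combine; finToFun; funToFin)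
open import Data.Fin.Patterns using (0F; 1F; 2F; 3F; 4F)
open import Data.Fin.Properties
  using (_≟_; _<?_; <-cmp; <-asym; all?; any?; punchIn-injective; punchInᵢ≢i;
         punchIn-punchOut; finToFun-funToFin; funToFin-finToFin)
open import Data.List.Base
  using (List; []; _∷_; allFin; cartesianProduct; filter; length; map; tabulate)
open import Data.List.Membership.Propositional using (_∈_)
open import Data.List.Membership.Propositional.Properties
  using (∈-allFin; ∈-cartesianProduct⁺; ∈-filter⁺; ∈-filter⁻; ∈-map⁺; ∈-map⁻; ∈-tabulate⁺; ∈-tabulate⁻)
open import Data.List.Properties
  using (filter-++; filter-notAll; length-++; length-map; length-tabulate)
open import Data.List.Relation.Binary.Subset.Propositional using (_⊆_)
import Data.List.Relation.Unary.All as All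
open import Data.List.Relation.Unary.All using (All; []; _∷_)
import Data.List.Relation.Unary.All.Properties as All
open import Data.List.Relation.Unary.AllPairs using ([]; _∷_)
import Data.List.Relation.Unary.Any as Any
open import Data.List.Relation.Unary.Any using (here; there)
open import Data.List.Relation.Unary.Unique.Propositional using (Unique)
import Data.List.Relation.Unary.Unique.Propositional.Properties as Unique
open import Data.Nat.Base using (ℕ; zero; suc; _+_; _≤_; s≤s; z≤n; _≥_; _*_; _∸_; _^_)
open import Data.Nat.ListAction using (sum)
import Data.Nat.Properties as ℕ
open import Data.Product.Base using (∃; ∃₂; _×_; _,_; proj₁; proj₂)
open import Data.Product.Properties using (≡-dec)
open import Data.Sum.Base using (_⊎_; inj₁; inj₂; [_,_]′; swap)
open import Data.Vec.Base using (lookup; []; _∷_)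
import Data.Vec.Relation.Unary.All as VecAll
import Data.Vec.Relation.Unary.AllPairs as VecAllPairs
import Data.Vec.Relation.Unary.Unique.Propositional.Properties as VecUnique
open import Function.Base using (_∘_)
open import Function.Bundles using (Inverse; mk⇔)
open import Level using (0ℓ)
open import Relation.Binary.Definitions using (DecidableEquality; tri<; tri≈; tri>)
open import Relation.Binary.PropositionalEquality
  using (_≡_; _≢_; _≗_; refl; sym; trans; cong; cong₂; subst; subst₂; setoid)
open import Relation.Nullary.Decidable
  using (Dec; yes; no; ⌊_⌋; toWitness; fromWitness; from-yes; does-⇔; ¬?; _×-dec_; _⊎-dec_; _→-dec_)
open import Relation.Nullary.Negation.Core using (¬_; contradiction)
open import Relation.Unary using (Pred; Decidable)
open import Defs

private
  variable
    A B : Set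
    m n : ℕ

T-injective : ∀ {x y} → (T x → T y) → (T y → T x) → x ≡ y
T-injective {x} {y} f g = does-⇔ (mk⇔ f g) (T? x) (T? y)

funToFin-cong : {f g : Fin m → Fin n} → f ≗ g → funToFin f ≡ funToFin g
funToFin-cong {zero}  f≗g = refl
funToFin-cong {suc m} f≗g = cong₂ combine (f≗g 0F) (funToFin-cong (f≗g ∘ Fin.suc))

-- Counting

module _ (_≟ᴬ_ : DecidableEquality A) where

  -- Induction on `xs`: deleting the head from `ys` makes `ys` shorter, and the tail still fits
  -- because the head does not recur in it.
  Unique⇒⊆⇒length≤ : ∀ {xs ys : List A} → Unique xs → xs ⊆ ys → length xs ≤ length ys
  Unique⇒⊆⇒length≤ []           _     = z≤n
  Unique⇒⊆⇒length≤ {x ∷ xs} {ys} (x∉xs ∷ xs!) xs⊆ys =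
    ℕ.≤-trans (s≤s (Unique⇒⊆⇒length≤ xs! λ {y} y∈xs →
                 ∈-filter⁺ (¬? ∘ (x ≟ᴬ_)) (xs⊆ys (there y∈xs)) (All.lookup x∉xs y∈xs)))
              (filter-notAll (¬? ∘ (x ≟ᴬ_)) ys
                 (Any.map (λ x≡y x≢y → x≢y x≡y) (xs⊆ys (here refl))))

  -- An element `y` of `ys` missing from `xs` would make `y ∷ xs` a duplicate-free list inside `ys`
  -- that is too long.
  Unique⇒⊆⇒length≥⇒⊇ : ∀ {xs ys : List A} → Unique xs → xs ⊆ ys →
                        length ys ≤ length xs → ys ⊆ xs
  Unique⇒⊆⇒length≥⇒⊇ {xs} {ys} xs! xs⊆ys ∣ys∣≤∣xs∣ {y} y∈ys with Any.any? (y ≟ᴬ_) xs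
  ... | yes y∈xs = y∈xs
  ... | no  y∉xs = contradiction
    (ℕ.≤-trans (Unique⇒⊆⇒length≤ (All.¬Any⇒All¬ xs y∉xs ∷ xs!) y∷xs⊆ys) ∣ys∣≤∣xs∣)
    ℕ.1+n≰n
    where
    y∷xs⊆ys : y ∷ xs ⊆ ys
    y∷xs⊆ys (here refl)  = y∈ys
    y∷xs⊆ys (there z∈xs) = xs⊆ys z∈xs

length-filter-map : ∀ {P : Pred B 0ℓ} (P? : Decidable P) (f : A → B) xs →
                    length (filter P? (map f xs)) ≡ length (filter (P? ∘ f) xs)
length-filter-map P? f []       = refl
length-filter-map P? f (x ∷ xs) with P? (f x)
... | yes _ = cong suc (length-filter-map P? f xs)
... | no  _ = length-filter-map P? f xs

length-filter-cartesianProduct :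
  ∀ {P : Pred (A × B) 0ℓ} (P? : Decidable P) xs ys →
  length (filter P? (cartesianProduct xs ys)) ≡
  sum (map (λ x → length (filter (λ y → P? (x , y)) ys)) xs)
length-filter-cartesianProduct P? []       ys = refl
length-filter-cartesianProduct P? (x ∷ xs) ys =
  trans (cong length (filter-++ P? (map (x ,_) ys) (cartesianProduct xs ys)))
    (trans (length-++ (filter P? (map (x ,_) ys)))
      (cong₂ _+_ (length-filter-map P? (x ,_) ys) (length-filter-cartesianProduct P? xs ys)))

length-allFin : ∀ n → length (allFin n) ≡ n
length-allFin n = length-tabulate {n = n} _

module _ (f : A → ℕ) where

  sum-map-≤ : (∀ x → f x ≤ m) → ∀ xs → sum (map f xs) ≤ length xs * m
  sum-map-≤ f≤m []       = z≤n
  sum-map-≤ f≤m (x ∷ xs) = ℕ.+-mono-≤ (f≤m x) (sum-map-≤ f≤m xs)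

  sum-map-≥ : (∀ x → m ≤ f x) → ∀ xs → length xs * m ≤ sum (map f xs)
  sum-map-≥ m≤f []       = z≤n
  sum-map-≥ m≤f (x ∷ xs) = ℕ.+-mono-≤ (m≤f x) (sum-map-≥ m≤f xs)

  -- No term has slack: bounding the tail from above forces the head up to `m`, and bounding the
  -- head from above passes the hypothesis on to the tail.
  sum-map-tight : (∀ x → f x ≤ m) → ∀ xs → length xs * m ≤ sum (map f xs) →
                  All (λ x → m ≤ f x) xs
  sum-map-tight         f≤m []       _ = []
  sum-map-tight {m = m} f≤m (x ∷ xs) h =
    ℕ.+-cancelʳ-≤ (length xs * m) m (f x)
      (ℕ.≤-trans h (ℕ.+-monoʳ-≤ (f x) (sum-map-≤ f≤m xs))) ∷
    sum-map-tight f≤m xs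
      (ℕ.+-cancelˡ-≤ m _ _ (ℕ.≤-trans h (ℕ.+-monoˡ-≤ _ (f≤m x))))

-- Unordered pairs

_∈[_,_] : Fin n → Fin n → Fin n → Set
c ∈[ a , b ] = c ≡ a ⊎ c ≡ b

_∈[_,_]? : (c a b : Fin n) → Dec (c ∈[ a , b ])
c ∈[ a , b ]? = (c ≟ a) ⊎-dec (c ≟ b)

-- Edge lists hold each tail in increasing order only; this gives that representative of a tail
-- written in either order.
sort : Fin n → Fin n → Fin n × Fin n
sort a b with a <? b
... | yes _ = a , b
... | no  _ = b , a

sort-< : {a b : Fin n} → a < b → sort a b ≡ (a , b)
sort-< {a = a} {b} a<b with a <? b
... | yes _   = refl
... | no  a≮b = contradiction a<b a≮b

sort-> : {a b : Fin n} → b < a → sort a b ≡ (b , a)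
sort-> {a = a} {b} b<a with a <? b
... | yes a<b = contradiction a<b (<-asym b<a)
... | no  _   = refl

-- Keeps the edges of a star with centre `c` distinct. If the two comparisons disagree, equality of
-- the pairs forces both `a` and `b` to be `c`.
sort-injective : (c : Fin n) {a b : Fin n} → sort c a ≡ sort c b → a ≡ b
sort-injective c {a} {b} eq with c <? a | c <? b | eq
... | yes _ | yes _ | refl = refl
... | yes _ | no  _ | refl = refl
... | no  _ | yes _ | refl = refl
... | no  _ | no  _ | refl = refl

sort-unique : {a b u v : Fin n} → a < b → u ≢ v → u ∈[ a , b ] → v ∈[ a , b ] →
              (a , b) ≡ sort u v
sort-unique a<b u≢v (inj₁ refl) (inj₁ refl) = contradiction refl u≢v
sort-unique a<b u≢v (inj₁ refl) (inj₂ refl) = sym (sort-< a<b)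
sort-unique a<b u≢v (inj₂ refl) (inj₁ refl) = sym (sort-> a<b)
sort-unique a<b u≢v (inj₂ refl) (inj₂ refl) = contradiction refl u≢v

-- Links

_≟²_ : DecidableEquality (Fin n × Fin n)
_≟²_ = ≡-dec _≟_ _≟_

IsLinkEdge? : (H : Graph n) (x : Fin n) →
              Decidable (λ ((a , b) : Fin n × Fin n) → a < b × T (edge H a b x))
IsLinkEdge? H x (a , b) = (a <? b) ×-dec T? (edge H a b x)

linkEdges : Graph n → Fin n → List (Fin n × Fin n)
linkEdges {n} H x = filter (IsLinkEdge? H x) (cartesianProduct (allFin n) (allFin n))

degree : Graph n → Fin n → ℕ
degree H x = length (linkEdges H x)

-- `edges` puts the head in the first coordinate, so filtering the product splits into one block per
-- head.
#edges≡sum-degree : (H : Graph n) → #edges H ≡ sum (map (degree H) (allFin n))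
#edges≡sum-degree {n} H = length-filter-cartesianProduct _ (allFin n) _

linkEdges-unique : (H : Graph n) (x : Fin n) → Unique (linkEdges H x)
linkEdges-unique {n} H x =
  Unique.filter⁺ (IsLinkEdge? H x) (Unique.cartesianProduct⁺ (Unique.allFin⁺ n) (Unique.allFin⁺ n))

module _ (H : Graph n) {x : Fin n} where

  ∈-linkEdges⁺ : ∀ {a b} → a < b → T (edge H a b x) → (a , b) ∈ linkEdges H x
  ∈-linkEdges⁺ a<b e =
    ∈-filter⁺ (IsLinkEdge? H x) (∈-cartesianProduct⁺ (∈-allFin _) (∈-allFin _)) (a<b , e)

  ∈-linkEdges⁻ : ∀ {a b} → (a , b) ∈ linkEdges H x → a < b × T (edge H a b x)
  ∈-linkEdges⁻ = proj₂ ∘ ∈-filter⁻ (IsLinkEdge? H x) {xs = cartesianProduct (allFin n) (allFin n)}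

  edge-sym : ∀ {a b} → T (edge H a b x) → T (edge H b a x)
  edge-sym = subst T (symmetric H _ _ x)

  sort-∈-linkEdges⁺ : ∀ {a b} → T (edge H a b x) → sort a b ∈ linkEdges H x
  sort-∈-linkEdges⁺ {a} {b} e with <-cmp a b
  ... | tri< a<b _ _    rewrite sort-< a<b = ∈-linkEdges⁺ a<b e
  ... | tri≈ _ a≡b _    = contradiction a≡b (proj₁ (distinct H a b x e))
  ... | tri> _ _ b<a    rewrite sort-> b<a = ∈-linkEdges⁺ b<a (edge-sym e)

  sort-∈-linkEdges⁻ : ∀ {a b} → sort a b ∈ linkEdges H x → T (edge H a b x)
  sort-∈-linkEdges⁻ {a} {b} ∈E with a <? b
  ... | yes _ = proj₂ (∈-linkEdges⁻ ∈E)
  ... | no  _ = edge-sym (proj₂ (∈-linkEdges⁻ ∈E))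

-- Intersecting links

I₀-tails : List (Fin 5 × Fin 5)
I₀-tails = (0F , 1F) ∷ (1F , 0F) ∷ (2F , 3F) ∷ (3F , 2F) ∷ []

-- Decided over all triples of `Fin 5`; it reduces checking a homomorphism from `I₀` to four cases.
I₀-edge⁻ : ∀ a b c → T (I₀-edge a b c) → c ≡ 4F × (a , b) ∈ I₀-tails
I₀-edge⁻ = from-yes (all? λ a → all? λ b → all? λ c →
  T? (I₀-edge a b c) →-dec ((c ≟ 4F) ×-dec Any.any? ((a , b) ≟²_) I₀-tails))

Intersecting : Graph n → Fin n → Set
Intersecting {n} H x = ∀ {u v a b : Fin n} → T (edge H u v x) → T (edge H a b x) →
                       u ∈[ a , b ] ⊎ v ∈[ a , b ]

-- Two disjoint tails and their common head `x` are five distinct vertices, which span a copy of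
-- `I₀`.
I₀-free⇒intersecting : (H : Graph n) → H IsFreeOf I₀ → ∀ x → Intersecting H x
I₀-free⇒intersecting {n} H free x {u} {v} {a} {b} uv ab
  with u ∈[ a , b ]? | v ∈[ a , b ]?
... | yes u∈ | _      = inj₁ u∈
... | no _   | yes v∈ = inj₂ v∈
... | no u∉  | no v∉  = contradiction (φ , (λ {i} {j} → VecUnique.lookup-injective φ! i j) , hom) free
  where
  u≢v = proj₁ (distinct H u v x uv)
  u≢x = proj₁ (proj₂ (distinct H u v x uv))
  v≢x = proj₂ (proj₂ (distinct H u v x uv))
  a≢b = proj₁ (distinct H a b x ab)
  a≢x = proj₁ (proj₂ (distinct H a b x ab))
  b≢x = proj₂ (proj₂ (distinct H a b x ab))
  φ : Fin 5 → Fin n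
  φ = lookup (u ∷ v ∷ a ∷ b ∷ x ∷ [])
  φ! = (u≢v VecAll.∷ u∉ ∘ inj₁ VecAll.∷ u∉ ∘ inj₂ VecAll.∷ u≢x VecAll.∷ VecAll.[])
       VecAllPairs.∷ (v∉ ∘ inj₁ VecAll.∷ v∉ ∘ inj₂ VecAll.∷ v≢x VecAll.∷ VecAll.[])
       VecAllPairs.∷ (a≢b VecAll.∷ a≢x VecAll.∷ VecAll.[])
       VecAllPairs.∷ (b≢x VecAll.∷ VecAll.[])
       VecAllPairs.∷ VecAll.[]
       VecAllPairs.∷ VecAllPairs.[]
  hom : ∀ i j k → T (I₀-edge i j k) → T (edge H (φ i) (φ j) (φ k))
  hom i j k e with I₀-edge⁻ i j k e
  ... | refl , here refl                         = uv
  ... | refl , there (here refl)                 = edge-sym H uv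
  ... | refl , there (there (here refl))         = ab
  ... | refl , there (there (there (here refl))) = edge-sym H ab

IsCenter : Graph n → Fin n → Fin n → Set
IsCenter H x c = ∀ a b → T (edge H a b x) → c ∈[ a , b ]

-- A finite search, so that failure to be a centre comes with an explicit edge avoiding `c`.
isCenter⊎avoided : (H : Graph n) (x c : Fin n) →
                   IsCenter H x c ⊎ (∃₂ λ a b → T (edge H a b x) × ¬ c ∈[ a , b ])
isCenter⊎avoided H x c
  with any? (λ a → any? λ b → T? (edge H a b x) ×-dec ¬? (c ∈[ a , b ]?))
... | yes avoided = inj₂ avoided
... | no  ¬avoided = inj₁ isCenter
  where
  isCenter : IsCenter H x c
  isCenter a b e with c ∈[ a , b ]?
  ... | yes c∈ = c∈
  ... | no  c∉ = contradiction (a , b , e , c∉) ¬avoided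

-- Stars

-- The centre of a star at head `x` is coded as `punchIn x k`: it differs from `x` by construction,
-- and `k` ranges over exactly n - 1 choices. The second `punchIn` skips the centre too.
leaves : Fin (2 + m) → Fin (1 + m) → List (Fin (2 + m))
leaves x k = tabulate (punchIn x ∘ punchIn k)

∈-leaves : (x : Fin (2 + m)) (k : Fin (1 + m)) {a : Fin (2 + m)} →
           x ≢ a → punchIn x k ≢ a → a ∈ leaves x k
∈-leaves x k {a} x≢a c≢a = subst (_∈ leaves x k) eq (∈-tabulate⁺ (punchOut k≢j))
  where
  k≢j : k ≢ punchOut x≢a
  k≢j k≡j = c≢a (trans (cong (punchIn x) k≡j) (punchIn-punchOut x≢a))
  eq : punchIn x (punchIn k (punchOut k≢j)) ≡ a
  eq = trans (cong (punchIn x) (punchIn-punchOut k≢j)) (punchIn-punchOut x≢a)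

starEdges : Fin (2 + m) → Fin (1 + m) → List (Fin (2 + m) × Fin (2 + m))
starEdges x k = map (sort (punchIn x k)) (leaves x k)

length-starEdges : (x : Fin (2 + m)) (k : Fin (1 + m)) → length (starEdges x k) ≡ m
length-starEdges x k =
  trans (length-map (sort (punchIn x k)) (leaves x k)) (length-tabulate (punchIn x ∘ punchIn k))

starEdges-unique : (x : Fin (2 + m)) (k : Fin (1 + m)) → Unique (starEdges x k)
starEdges-unique x k =
  Unique.map⁺ (sort-injective _)
    (Unique.tabulate⁺ λ {i} {j} → punchIn-injective k i j ∘ punchIn-injective x _ _)

linkEdges⊆starEdges : (H : Graph (2 + m)) (x : Fin (2 + m)) (k : Fin (1 + m)) →
                      IsCenter H x (punchIn x k) → linkEdges H x ⊆ starEdges x k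
linkEdges⊆starEdges H x k center {a , b} ab∈E
  with a<b , e ← ∈-linkEdges⁻ H ab∈E
  with a≢b , a≢x , b≢x ← distinct H a b x e
  with center a b e
... | inj₁ refl = subst (_∈ starEdges x k) (sort-< a<b) (∈-map⁺ _ (∈-leaves x k (b≢x ∘ sym) a≢b))
... | inj₂ refl = subst (_∈ starEdges x k) (sort-> a<b) (∈-map⁺ _ (∈-leaves x k (a≢x ∘ sym) (a≢b ∘ sym)))

-- If neither end of an edge `pq` is a centre, some edge `qr` avoids `p` and some edge `ps` avoids
-- `q`. These two meet only if `r` is `s`, and then every edge is a side of the triangle `pqr`.
Intersecting⇒star⊎triangle : (H : Graph (2 + m)) (x : Fin (2 + m)) → Intersecting H x →
                            (∃ λ k → IsCenter H x (punchIn x k)) ⊎ degree H x ≤ 3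
-- The first candidate is arbitrary: it is a centre, as it is when the link is empty, or the search
-- supplies an edge `pq` to start from.
Intersecting⇒star⊎triangle H x meet with isCenter⊎avoided H x (punchIn x 0F)
... | inj₁ center = inj₁ (0F , center)
... | inj₂ (p , q , pq , _) with isCenter⊎avoided H x p | isCenter⊎avoided H x q
...   | inj₁ center | _ =
  inj₁ (punchOut x≢p , subst (IsCenter H x) (sym (punchIn-punchOut x≢p)) center)
  where x≢p = proj₁ (proj₂ (distinct H p q x pq)) ∘ sym
...   | inj₂ _ | inj₁ center =
  inj₁ (punchOut x≢q , subst (IsCenter H x) (sym (punchIn-punchOut x≢q)) center)
  where x≢q = proj₂ (proj₂ (distinct H p q x pq)) ∘ sym
...   | inj₂ (a , b , ab , p∉ab) | inj₂ (c , d , cd , q∉cd) =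
  inj₂ (triangle (third pq ab p∉ab) (third (edge-sym H pq) cd q∉cd))
  where
  -- The edge `ab` meets `pq` but avoids `p`, so it contains `q`; its other end is `r`.
  third : ∀ {p q a b} → T (edge H p q x) → T (edge H a b x) → ¬ p ∈[ a , b ] →
          ∃ λ r → T (edge H q r x) × p ≢ r
  third {a = a} {b} pq ab p∉ab with meet pq ab
  ... | inj₁ p∈ab        = contradiction p∈ab p∉ab
  ... | inj₂ (inj₁ refl) = b , ab , p∉ab ∘ inj₂
  ... | inj₂ (inj₂ refl) = a , edge-sym H ab , p∉ab ∘ inj₁

  triangle : (∃ λ r → T (edge H q r x) × p ≢ r) → (∃ λ s → T (edge H p s x) × q ≢ s) →
             degree H x ≤ 3
  triangle (r , qr , p≢r) (s , ps , q≢s) = Unique⇒⊆⇒length≤ _≟²_ (linkEdges-unique H x) E⊆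
    where
    p≢q = proj₁ (distinct H p q x pq)
    q≢r = proj₁ (distinct H q r x qr)

    r≡s : r ≡ s
    r≡s with meet qr ps
    ... | inj₁ (inj₁ q≡p) = contradiction (sym q≡p) p≢q
    ... | inj₁ (inj₂ q≡s) = contradiction q≡s q≢s
    ... | inj₂ (inj₁ r≡p) = contradiction (sym r≡p) p≢r
    ... | inj₂ (inj₂ r≡s) = r≡s

    pr : T (edge H p r x)
    pr = subst (λ t → T (edge H p t x)) (sym r≡s) ps

    E⊆ : linkEdges H x ⊆ sort p q ∷ sort q r ∷ sort p r ∷ []
    -- Each side omits one corner, so an edge that meets all three sides contains two corners.
    E⊆ {a , b} ab∈E with a<b , ab ← ∈-linkEdges⁻ H ab∈E
      with meet pq ab | meet qr ab | meet pr ab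
    ... | inj₁ p∈ | inj₁ q∈ | _       = here (sort-unique a<b p≢q p∈ q∈)
    ... | inj₁ p∈ | inj₂ r∈ | _       = there (there (here (sort-unique a<b p≢r p∈ r∈)))
    ... | inj₂ q∈ | _       | inj₁ p∈ = here (sort-unique a<b p≢q p∈ q∈)
    ... | inj₂ q∈ | _       | inj₂ r∈ = there (here (sort-unique a<b q≢r q∈ r∈))

-- Upper bounds on degrees and edges

module _ (H : Graph (2 + m)) (free : H IsFreeOf I₀) where

  -- A star has m = n - 2 possible edges; the three edges of a triangle stay within this bound once
  -- n ≥ 5.
  degree≤ : 3 ≤ m → ∀ x → degree H x ≤ m
  degree≤ 3≤m x with Intersecting⇒star⊎triangle H x (I₀-free⇒intersecting H free x)
  ... | inj₂ deg≤3        = ℕ.≤-trans deg≤3 3≤m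
  ... | inj₁ (k , center) = subst (degree H x ≤_) (length-starEdges x k)
    (Unique⇒⊆⇒length≤ _≟²_ (linkEdges-unique H x) (linkEdges⊆starEdges H x k center))

  #edges≤ : 3 ≤ m → #edges H ≤ (2 + m) * m
  #edges≤ 3≤m =
    subst₂ _≤_ (sym (#edges≡sum-degree H)) (cong (_* m) (length-allFin (2 + m)))
      (sum-map-≤ (degree H) (degree≤ 3≤m) (allFin (2 + m)))

  #edges≥⇒degree≥ : 3 ≤ m → (2 + m) * m ≤ #edges H → ∀ x → m ≤ degree H x
  #edges≥⇒degree≥ 3≤m h x = All.lookup
    (sum-map-tight (degree H) (degree≤ 3≤m) (allFin (2 + m))
      (subst₂ _≤_ (cong (_* m) (sym (length-allFin (2 + m)))) (#edges≡sum-degree H) h))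
    (∈-allFin x)

-- Star graphs

IsStarEdge : Fin (2 + m) → Fin (1 + m) → Fin (2 + m) → Fin (2 + m) → Set
IsStarEdge x k a b = a ≢ b × a ≢ x × b ≢ x × punchIn x k ∈[ a , b ]

isStarEdge? : (x : Fin (2 + m)) (k : Fin (1 + m)) (a b : Fin (2 + m)) → Dec (IsStarEdge x k a b)
isStarEdge? x k a b =
  ¬? (a ≟ b) ×-dec ¬? (a ≟ x) ×-dec ¬? (b ≟ x) ×-dec (punchIn x k ∈[ a , b ]?)

isStarEdge : Fin (2 + m) → Fin (1 + m) → Fin (2 + m) → Fin (2 + m) → Bool
isStarEdge x k a b = ⌊ isStarEdge? x k a b ⌋

isStarEdge-sym : (x : Fin (2 + m)) (k : Fin (1 + m)) → ∀ a b →
                 T (isStarEdge x k a b) → T (isStarEdge x k b a)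
isStarEdge-sym x k a b e with a≢b , a≢x , b≢x , c∈ ← toWitness {a? = isStarEdge? x k a b} e =
  fromWitness (a≢b ∘ sym , b≢x , a≢x , swap c∈)

starGraph : (Fin (2 + m) → Fin (1 + m)) → Graph (2 + m)
starGraph f = record
  { edge      = λ a b x → isStarEdge x (f x) a b
  ; symmetric = λ a b x → T-injective (isStarEdge-sym x (f x) a b) (isStarEdge-sym x (f x) b a)
  ; distinct  = λ a b x e → let a≢b , a≢x , b≢x , _ = toWitness {a? = isStarEdge? x (f x) a b} e
                            in a≢b , a≢x , b≢x
  }

center-leaf : (x : Fin (2 + m)) {k l : Fin (1 + m)} → k ≢ l →
              T (isStarEdge x k (punchIn x k) (punchIn x l))
center-leaf x {k} {l} k≢l = fromWitness
  (k≢l ∘ punchIn-injective x k l , punchInᵢ≢i x k , punchInᵢ≢i x l , inj₁ refl)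

-- A centre is recognised by its star only if the star has two edges, hence the four vertices: a
-- single edge could have either end as its centre.
isStarEdge-injective : (x : Fin (4 + m)) {k l : Fin (3 + m)} →
                       (∀ a b → isStarEdge x k a b ≡ isStarEdge x l a b) → k ≡ l
isStarEdge-injective x {k} {l} same with k ≟ l
... | yes k≡l = k≡l
... | no  k≢l = contradiction l∈ [ k≢l ∘ sym ∘ punchIn-injective x l k , l≢j ∘ punchIn-injective x l j ]′
  where
  -- An index other than `k` and `l`: `punchOut k≢l` is the position of `l` once `k` is removed. The
  -- spoke from centre `k` to `j` then misses `l`.
  j = punchIn k (punchIn (punchOut k≢l) 0F)
  k≢j : k ≢ j
  k≢j = punchInᵢ≢i k _ ∘ sym
  l≢j : l ≢ j
  l≢j l≡j = punchInᵢ≢i (punchOut k≢l) 0F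
    (punchIn-injective k _ _ (trans (sym l≡j) (sym (punchIn-punchOut k≢l))))
  l∈ : punchIn x l ∈[ punchIn x k , punchIn x j ]
  l∈ = proj₂ (proj₂ (proj₂ (toWitness (subst T (same _ _) (center-leaf x k≢j)))))

module _ (f : Fin (2 + m) → Fin (1 + m)) where

  -- Both tails of a copy of `I₀` would contain the centre chosen for the head `φ 4F`, so `φ` would
  -- identify a vertex of one tail with a vertex of the other.
  starGraph-free : starGraph f IsFreeOf I₀
  starGraph-free (φ , φ-inj , hom) with center 0F 1F _ | center 2F 3F _
    where
    center : ∀ a b → T (I₀-edge a b 4F) → punchIn (φ 4F) (f (φ 4F)) ∈[ φ a , φ b ]
    center a b e = proj₂ (proj₂ (proj₂ (toWitness (hom a b 4F e))))
  ... | inj₁ p | inj₁ q with () ← φ-inj (trans (sym p) q)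
  ... | inj₁ p | inj₂ q with () ← φ-inj (trans (sym p) q)
  ... | inj₂ p | inj₁ q with () ← φ-inj (trans (sym p) q)
  ... | inj₂ p | inj₂ q with () ← φ-inj (trans (sym p) q)

  degree-starGraph≥ : ∀ x → m ≤ degree (starGraph f) x
  degree-starGraph≥ x = subst (_≤ degree (starGraph f) x) (length-starEdges x (f x))
    (Unique⇒⊆⇒length≤ _≟²_ (starEdges-unique x (f x)) star⊆E)
    where
    star⊆E : starEdges x (f x) ⊆ linkEdges (starGraph f) x
    star⊆E e∈ with a , a∈ , refl ← ∈-map⁻ (sort (punchIn x (f x))) e∈
      with i , refl ← ∈-tabulate⁻ {f = punchIn x ∘ punchIn (f x)} a∈ =
      sort-∈-linkEdges⁺ (starGraph f) (center-leaf x (punchInᵢ≢i (f x) i ∘ sym))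

  #edges-starGraph≥ : (2 + m) * m ≤ #edges (starGraph f)
  #edges-starGraph≥ =
    subst₂ _≤_ (cong (_* m) (length-allFin (2 + m))) (sym (#edges≡sum-degree (starGraph f)))
      (sum-map-≥ (degree (starGraph f)) degree-starGraph≥ (allFin (2 + m)))

  starGraph-extremal : 3 ≤ m → IsExtremal I₀ (starGraph f)
  starGraph-extremal 3≤m =
    starGraph-free , λ G free → ℕ.≤-trans (#edges≤ G free 3≤m) #edges-starGraph≥

-- Links of extremal graphs

module _ (H : Graph (2 + m)) (4≤m : 4 ≤ m) where

  -- With m ≥ 4 a triangle has too few edges. Otherwise the link lies in a star with m edges and,
  -- having at least m itself, fills it.
  degree≥⇒link-star : H IsFreeOf I₀ → ∀ x → m ≤ degree H x →
                      ∃ λ k → ∀ a b → edge H a b x ≡ isStarEdge x k a b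
  degree≥⇒link-star free x m≤deg
    with Intersecting⇒star⊎triangle H x (I₀-free⇒intersecting H free x)
  ... | inj₂ deg≤3        = contradiction (ℕ.≤-trans 4≤m (ℕ.≤-trans m≤deg deg≤3)) ℕ.1+n≰n
  ... | inj₁ (k , center) = k , λ a b → T-injective (link⇒star a b) (star⇒link a b)
    where
    link⇒star : ∀ a b → T (edge H a b x) → T (isStarEdge x k a b)
    link⇒star a b e = let a≢b , a≢x , b≢x = distinct H a b x e in
      fromWitness (a≢b , a≢x , b≢x , center a b e)

    star⊆E : starEdges x k ⊆ linkEdges H x
    star⊆E = Unique⇒⊆⇒length≥⇒⊇ _≟²_ (linkEdges-unique H x) (linkEdges⊆starEdges H x k center)
      (subst (_≤ degree H x) (sym (length-starEdges x k)) m≤deg)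

    spoke : ∀ {a} → a ≢ x → punchIn x k ≢ a → T (edge H (punchIn x k) a x)
    spoke a≢x c≢a = sort-∈-linkEdges⁻ H (star⊆E (∈-map⁺ _ (∈-leaves x k (a≢x ∘ sym) c≢a)))

    star⇒link : ∀ a b → T (isStarEdge x k a b) → T (edge H a b x)
    star⇒link a b e with toWitness {a? = isStarEdge? x k a b} e
    ... | a≢b , a≢x , b≢x , inj₁ refl = spoke b≢x a≢b
    ... | a≢b , a≢x , b≢x , inj₂ refl = edge-sym H (spoke a≢x (a≢b ∘ sym))

  extremal⇒link-star : IsExtremal I₀ H → ∀ x → ∃ λ k → ∀ a b → edge H a b x ≡ isStarEdge x k a b
  extremal⇒link-star (free , maximal) x = degree≥⇒link-star free x
    -- Comparison with one star graph shows that a maximal `H` has at least n(n - 2) edges; any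
    -- choice of centres `f` would serve.
    (#edges≥⇒degree≥ H free (ℕ.<⇒≤ 4≤m)
      (ℕ.≤-trans (#edges-starGraph≥ f) (maximal (starGraph f) (starGraph-free f))) x)
    where
    f : Fin (2 + m) → Fin (1 + m)
    f _ = 0F

-- The extremal number and the count of extremal graphs

ex-I₀ : 3 ≤ m → ex[ 2 + m , I₀ ]≡ ((2 + m) * m)
ex-I₀ {m} 3≤m = starGraph f , starGraph-extremal f 3≤m ,
  ℕ.≤-antisym (#edges≤ (starGraph f) (starGraph-free f) 3≤m) (#edges-starGraph≥ f)
  where
  f : Fin (2 + m) → Fin (1 + m)
  f _ = 0F

extremalGraphs-I₀ : 4 ≤ m → Inverse (setoid (Fin ((1 + m) ^ (2 + m)))) (extremalGraphs (2 + m) I₀)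
-- Matching two successors exposes `m` as 2 plus a number, which gives the four vertices that
-- `isStarEdge-injective` asks for. `finToFun` and `funToFin` code the choices of centres as numbers
-- below `(1 + m) ^ (2 + m)`.
extremalGraphs-I₀ {m} 4≤m@(s≤s (s≤s _)) = record
  { to        = λ i → starGraph (finToFun i) , starGraph-extremal (finToFun i) (ℕ.<⇒≤ 4≤m)
  ; from      = funToFin ∘ centers
  ; to-cong   = λ { refl a b x → refl }
  -- The centres of `G` and `H` come from separate searches; they agree because a star determines
  -- its centre.
  ; from-cong = λ {G} {H} G≈H → funToFin-cong (centers-unique G (centers H) λ a b x →
                  trans (G≈H a b x) (≈starGraph-centers H a b x))
  ; inverse   = (λ {H} → λ { refl a b x → trans
                  (cong (λ k → isStarEdge x k a b) (finToFun-funToFin (centers H) x))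
                  (sym (≈starGraph-centers H a b x)) })
              , λ {i} {H} H≈ → trans (funToFin-cong (centers-unique H (finToFun i) H≈))
                                     (funToFin-finToFin {2 + m} i)
  }
  where
  centers : ∃ (IsExtremal I₀) → Fin (2 + m) → Fin (1 + m)
  centers (H , ext) x = proj₁ (extremal⇒link-star H 4≤m ext x)

  ≈starGraph-centers : ∀ H → proj₁ H ≈ starGraph (centers H)
  ≈starGraph-centers (H , ext) a b x = proj₂ (extremal⇒link-star H 4≤m ext x) a b

  centers-unique : ∀ H f → proj₁ H ≈ starGraph f → centers H ≗ f
  centers-unique H f H≈ x = isStarEdge-injective x λ a b →
    trans (sym (≈starGraph-centers H a b x)) (H≈ a b x)

theorem2p2 : (∀ (n : ℕ) → n ≥ 5 → ex[ n , I₀ ]≡ (n * (n ∸ 2)))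
    × (∀ (n : ℕ) → n ≥ 6 → Inverse (setoid (Fin ((n ∸ 1) ^ n))) (extremalGraphs n I₀))
-- Writing n as 2 + m turns the truncated differences `n ∸ 2` and `n ∸ 1` into `m` and `1 + m`.
theorem2p2 = (λ { (suc (suc m)) (s≤s (s≤s 3≤m)) → ex-I₀ 3≤m })
           , (λ { (suc (suc m)) (s≤s (s≤s 4≤m)) → extremalGraphs-I₀ 4≤m })
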